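{- For every integer $k\geq 1$ there is a constant $C=C(k)>0$ such that the following holds. Let $G$ be a finite group and let $A\subseteq G$ be $k$-stable. Then for every $\epsilon$ with $0<\epsilon\leq \frac12$ there are a subgroup $H\leq G$ of index at most $\epsilon^{ -C}$ and a set $D\subseteq G$ which is a union of left cosets of $H$ such that $|A\,\triangle\, D|<\epsilon|H|$.
   Context: A subset $A$ of a group $G$ is called $k$-stable if there do not exist $a_1,\ldots,a_k,b_1,\ldots,b_k\in G$ such that $a_ib_j\in A$ if and only if $i\leq j$. $\triangle$ denotes symmetric difference. -}

module Defs where

open import Data.Nat using (ℕ)
open import Data.Fin using (Fin) renaming (_≤_ to _≤ᶠ_)
open import Data.Fin.Subset using (Subset; _∈_; _∪_; _─_)
open import Data.Product using (Σ; _×_)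
open import Function.Bundles using (_⇔_)
open import Relation.Binary.PropositionalEquality using (_≡_)
open import Relation.Nullary using (¬_)

-- A finite group, presented (up to isomorphism) on the carrier Fin order.
record FiniteGroup : Set where
  field
    order   : ℕ
    _·_     : Fin order → Fin order → Fin order
    e       : Fin order
    inv     : Fin order → Fin order
    assoc   : ∀ x y z → (x · y) · z ≡ x · (y · z)
    identityˡ : ∀ x → e · x ≡ x
    identityʳ : ∀ x → x · e ≡ x
    inverseˡ  : ∀ x → inv x · x ≡ e
    inverseʳ  : ∀ x → x · inv x ≡ e

module _ (G : FiniteGroup) where
  open FiniteGroup G

  IsSubgroup : Subset order → Set
  IsSubgroup H = (e ∈ H)
               × (∀ x y → x ∈ H → y ∈ H → (x · y) ∈ H)
               × (∀ x → x ∈ H → inv x ∈ H)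

  IsStable : ℕ → Subset order → Set
  IsStable k A = ¬ (Σ (Fin k → Fin order) λ a → Σ (Fin k → Fin order) λ b →
                     ∀ (i j : Fin k) → (((a i · b j) ∈ A) ⇔ (i ≤ᶠ j)))

  IsUnionOfLeftCosets : Subset order → Subset order → Set
  IsUnionOfLeftCosets H D =
    Σ (Subset order) λ T → ∀ g →
      ((g ∈ D) ⇔ Σ (Fin order) λ t → (t ∈ T) × Σ (Fin order) λ h → (h ∈ H) × (g ≡ t · h))

_△_ : ∀ {n} → Subset n → Subset n → Subset n
A △ D = (A ─ D) ∪ (D ─ A)

{-# OPTIONS --safe #-}
module Submission where

-- Write ε = p / q.  Stability bounds the height of binary trees that split G by
-- the conditions g x ∈ A, so splitting greedily ends, after boundedly many steps,
-- at a set Y of density α ≥ ε^O(1) that no g splits: for every g, the condition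
-- g x ∈ A has the same truth value B g for all x ∈ Y but fewer than ε² α ∣Y∣.
-- If Y and w Y share more than twice that many points, then right translation by
-- w preserves B.  Since ∣Y∣² = Σ_w ∣Y ∩ w Y∣, the stabiliser of B has at least
-- ∣Y∣ / 2 elements.  Averaging over Y gives an x with ∣A △ B x∣ < ε² ∣Y∣, and
-- B x is a union of left cosets of its stabiliser, a conjugate of that of B.

open import Defs
open import Data.Nat.Properties hiding (_≟_)
open import Algebra.Properties.Semiring.Sum +-*-semiring
  using (sum; sum-cong-≗; ∑-distrib-+; ∑-comm; sum-permute; *-distribˡ-sum; *-distribʳ-sum)
open import Data.Bool using (Bool; true; false; not; _∧_; _xor_)
open import Data.Bool.Properties using (_≟_; not-¬)
open import Data.Fin
  using (Fin; zero; suc; toℕ; inject₁; opposite)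
  renaming (_≤_ to _≤ᶠ_; _<_ to _<ᶠ_)
open import Data.Fin.Permutation using (permutation)
open import Data.Fin.Properties
  using (any?; all?; ¬∀⟶∃¬; nonZeroIndex; toℕ<n; toℕ-inject₁; opposite-prop)
open import Data.Fin.Subset using (Subset; ∣_∣; _∈_)
open import Data.Nat
  using (ℕ; zero; suc; _+_; _*_; _^_; _≤_; _<_; z≤n; s≤s; z<s; s<s; s≤s⁻¹; NonZero; _<?_;
         >-nonZero; >-nonZero⁻¹)
open import Data.Nat.Tactic.RingSolver using (solve-∀)
open import Data.Product using (Σ; _×_; _,_; proj₁; proj₂; ∃)
open import Data.Sum using (_⊎_; inj₁; inj₂)
open import Data.Vec using (lookup; tabulate; []; _∷_)
open import Data.Vec.Properties using (lookup∘tabulate; lookup⇒[]=; []=⇒lookup)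
open import Function using (_∘_; flip; id)
open import Function.Bundles using (_⇔_; mk⇔; Equivalence)
open import Level using (0ℓ)
open import Relation.Binary.Core using (REL; Rel)
open import Relation.Binary.Definitions using (Decidable)
open import Relation.Binary.PropositionalEquality
  using (_≡_; _≢_; refl; sym; trans; cong; cong₂; subst)
open import Relation.Nullary
  using (¬_; Dec; yes; no; does; proof; Reflects; invert; contradiction; _×-dec_; ¬?)
open import Relation.Nullary.Decidable using (dec-true)
open import Relation.Unary using (Pred; U; _∩_; _⊆_; ∁)

-- Split trees and half graphs of a relation.

-- A height at which a split tree must yield a half graph of size `s` for ≥ or of size `t` for <.
-- The sum in the last clause is what `SplitTree-ramsey` consumes; each `suc` pays for the root of
-- the monochromatic subtree.
treeHeight : ℕ → ℕ → ℕ
treeHeight zero    t       = zero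
treeHeight (suc s) zero    = zero
treeHeight (suc s) (suc t) = suc (treeHeight s (suc t)) + suc (treeHeight (suc s) t)

module _ {I J : Set} (R : REL I J 0ℓ) where

  -- The full binary trees of Shelah's 2-rank (Littlestone trees): every branch is realised by a
  -- point of `X`. The labels are confined to `P` so that a colouring of them can be tracked.
  SplitTree : ℕ → Pred I 0ℓ → Pred J 0ℓ → Set
  SplitTree zero    P X = ∃ X
  SplitTree (suc n) P X = Σ I λ g → P g × SplitTree n P (X ∩ R g) × SplitTree n P (X ∩ ∁ (R g))

  -- The order is a parameter because the two colours in the Ramsey step produce ≥ and <
  -- respectively; both are later reindexed to the ≤ of stability.
  record HalfGraph (n : ℕ) (_≺_ : Rel (Fin n) 0ℓ) (P : Pred I 0ℓ) (X : Pred J 0ℓ) : Set where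
    constructor halfGraph
    field
      left     : Fin n → I
      right    : Fin n → J
      left∈    : ∀ i → P (left i)
      right∈   : ∀ j → X (right j)
      adjacent : ∀ i j → R (left i) (right j) ⇔ i ≺ j

  SplitTree-mono : ∀ n {P P′ X X′} → P ⊆ P′ → X ⊆ X′ → SplitTree n P X → SplitTree n P′ X′
  SplitTree-mono zero    P⊆ X⊆ (x , Xx) = x , X⊆ Xx
  SplitTree-mono (suc n) P⊆ X⊆ (g , Pg , t , u) =
    g , P⊆ Pg
      , SplitTree-mono n P⊆ (λ (Xx , r) → X⊆ Xx , r) t
      , SplitTree-mono n P⊆ (λ (Xx , r) → X⊆ Xx , r) u

  SplitTree-inhabited : ∀ n {P X} → SplitTree n P X → ∃ X
  SplitTree-inhabited zero    t = t
  SplitTree-inhabited (suc n) (_ , _ , t , _) with SplitTree-inhabited n t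
  ... | x , Xx , _ = x , Xx

  -- Induction on `m + n`. If the root lies in `P₁`, apply the induction to both branches with `m`
  -- lowered: either both give a `P₁`-tree and the root joins them, or one already contains a
  -- `P₂`-tree of full height. A root in `P₂` is symmetric, with `n` lowered.
  SplitTree-ramsey : ∀ m n {P P₁ P₂ X} → (∀ {g} → P g → P₁ g ⊎ P₂ g) →
                     SplitTree (m + n) P X → SplitTree m P₁ X ⊎ SplitTree n P₂ X
  SplitTree-ramsey zero    n       cover t = inj₁ (SplitTree-inhabited n t)
  SplitTree-ramsey (suc m) zero    cover t = inj₂ (SplitTree-inhabited (suc m + zero) t)
  SplitTree-ramsey (suc m) (suc n) {P} {P₁} {P₂} {X} cover (g , Pg , t , u) with cover Pg
  ... | inj₁ P₁g with SplitTree-ramsey m (suc n) cover t | SplitTree-ramsey m (suc n) cover u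
  ...   | inj₁ t′ | inj₁ u′ = inj₁ (g , P₁g , t′ , u′)
  ...   | inj₂ t′ | _       = inj₂ (SplitTree-mono (suc n) id proj₁ t′)
  ...   | inj₁ _  | inj₂ u′ = inj₂ (SplitTree-mono (suc n) id proj₁ u′)
  SplitTree-ramsey (suc m) (suc n) {P} {P₁} {P₂} {X} cover (g , Pg , t , u) | inj₂ P₂g
    with SplitTree-ramsey (suc m) n cover (subst (λ k → SplitTree k P (X ∩ R g)) (+-suc m n) t)
       | SplitTree-ramsey (suc m) n cover (subst (λ k → SplitTree k P (X ∩ ∁ (R g))) (+-suc m n) u)
  ...   | inj₂ t′ | inj₂ u′ = inj₂ (g , P₂g , t′ , u′)
  ...   | inj₁ t′ | _       = inj₁ (SplitTree-mono (suc m) id proj₁ t′)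
  ...   | inj₂ _  | inj₁ u′ = inj₁ (SplitTree-mono (suc m) id proj₁ u′)

  HalfGraph-mono : ∀ {n _≺_ P P′ X X′} → P ⊆ P′ → X ⊆ X′ → HalfGraph n _≺_ P X → HalfGraph n _≺_ P′ X′
  HalfGraph-mono P⊆ X⊆ (halfGraph a b Pa Xb a≺b) =
    halfGraph a b (λ i → P⊆ (Pa i)) (λ j → X⊆ (Xb j)) a≺b

  -- The pair `g`, `h` takes index zero. The other right points lie outside `R g`, so row zero meets
  -- only column zero; the other left points are all related to `h`, so column zero is full.
  HalfGraph-cons-≥ : ∀ {n P X g h} → P g → X h → R g h →
                     HalfGraph n (flip _≤ᶠ_) (P ∩ (λ g′ → R g′ h)) (X ∩ ∁ (R g)) →
                     HalfGraph (suc n) (flip _≤ᶠ_) P X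
  HalfGraph-cons-≥ {n} {P} {X} {g} {h} Pg Xh Rgh (halfGraph a b Pa Xb a≥b) =
    halfGraph a′ b′
      (λ { zero → Pg ; (suc i) → proj₁ (Pa i) })
      (λ { zero → Xh ; (suc j) → proj₁ (Xb j) })
      λ { zero    zero    → mk⇔ (λ _ → z≤n) (λ _ → Rgh)
          ; zero    (suc j) → mk⇔ (λ r → contradiction r (proj₂ (Xb j))) λ ()
          ; (suc i) zero    → mk⇔ (λ _ → z≤n) (λ _ → proj₂ (Pa i))
          ; (suc i) (suc j) → mk⇔ (s≤s ∘ to (a≥b i j)) (from (a≥b i j) ∘ s≤s⁻¹) }
    where
    open Equivalence
    a′ = λ { zero → g ; (suc i) → a i }
    b′ = λ { zero → h ; (suc j) → b j }

  -- The complementary case: row zero meets every column but the first, and column zero is empty.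
  HalfGraph-cons-< : ∀ {n P X g h} → P g → X h → ¬ R g h →
                     HalfGraph n _<ᶠ_ (P ∩ (λ g′ → ¬ R g′ h)) (X ∩ R g) →
                     HalfGraph (suc n) _<ᶠ_ P X
  HalfGraph-cons-< {n} {P} {X} {g} {h} Pg Xh ¬Rgh (halfGraph a b Pa Xb a<b) =
    halfGraph a′ b′
      (λ { zero → Pg ; (suc i) → proj₁ (Pa i) })
      (λ { zero → Xh ; (suc j) → proj₁ (Xb j) })
      λ { zero    zero    → mk⇔ (λ r → contradiction r ¬Rgh) λ ()
          ; zero    (suc j) → mk⇔ (λ _ → z<s) (λ _ → proj₂ (Xb j))
          ; (suc i) zero    → mk⇔ (λ r → contradiction r (proj₂ (Pa i))) λ ()
          ; (suc i) (suc j) → mk⇔ (s<s ∘ to (a<b i j)) (from (a<b i j) ∘ s≤s⁻¹) }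
    where
    open Equivalence
    a′ = λ { zero → g ; (suc i) → a i }
    b′ = λ { zero → h ; (suc j) → b j }

  -- Fix h in X and colour the parameters g by R g h.  In a monochromatic subtree,
  -- the root paired with h starts the half graph, and the branch of the root
  -- opposite to the colour contains the rest of it.
  SplitTree⇒HalfGraph : Decidable R → ∀ s t {P X} → SplitTree (treeHeight s t) P X →
                        HalfGraph s (flip _≤ᶠ_) P X ⊎ HalfGraph t _<ᶠ_ P X
  SplitTree⇒HalfGraph R? zero    t    tree = inj₁ (halfGraph (λ ()) (λ ()) (λ ()) (λ ()) λ ())
  SplitTree⇒HalfGraph R? (suc s) zero tree = inj₂ (halfGraph (λ ()) (λ ()) (λ ()) (λ ()) λ ())
  SplitTree⇒HalfGraph R? (suc s) (suc t) {P} {X} tree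
    with SplitTree-inhabited (treeHeight (suc s) (suc t)) tree
  ... | h , Xh
    with SplitTree-ramsey (suc (treeHeight s (suc t))) (suc (treeHeight (suc s) t))
           {P₁ = P ∩ (λ g → R g h)} {P₂ = P ∩ (λ g → ¬ R g h)} cover tree
    where
    cover : ∀ {g} → P g → (P g × R g h) ⊎ (P g × ¬ R g h)
    cover {g} Pg with R? g h
    ... | yes r = inj₁ (Pg , r)
    ... | no ¬r = inj₂ (Pg , ¬r)
  ... | inj₁ (g , (Pg , Rgh) , _ , u) with SplitTree⇒HalfGraph R? s (suc t) u
  ...   | inj₁ hg = inj₁ (HalfGraph-cons-≥ Pg Xh Rgh hg)
  ...   | inj₂ hg = inj₂ (HalfGraph-mono {_≺_ = _<ᶠ_} proj₁ proj₁ hg)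
  SplitTree⇒HalfGraph R? (suc s) (suc t) {P} {X} tree
      | h , Xh
      | inj₂ (g , (Pg , ¬Rgh) , u , _) with SplitTree⇒HalfGraph R? (suc s) t u
  ...   | inj₁ hg = inj₁ (HalfGraph-mono {_≺_ = flip _≤ᶠ_} proj₁ proj₁ hg)
  ...   | inj₂ hg = inj₂ (HalfGraph-cons-< Pg Xh ¬Rgh hg)

  -- Reversing the indices on both sides reverses the order.
  HalfGraph-≥⇒≤ : ∀ {n P X} → HalfGraph n (flip _≤ᶠ_) P X → HalfGraph n _≤ᶠ_ P X
  HalfGraph-≥⇒≤ {n} (halfGraph a b Pa Xb a≥b) =
    halfGraph (a ∘ opposite) (b ∘ opposite) (Pa ∘ opposite) (Xb ∘ opposite)
    λ i j → mk⇔ (opposite-cancel-≤ i j ∘ to (a≥b _ _)) (from (a≥b _ _) ∘ opposite-anti-≤ i j)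
    where
    open Equivalence
    opposite-anti-≤ : ∀ (i j : Fin n) → i ≤ᶠ j → opposite j ≤ᶠ opposite i
    opposite-anti-≤ i j i≤j rewrite opposite-prop i | opposite-prop j = ∸-monoʳ-≤ n (s≤s i≤j)
    opposite-cancel-≤ : ∀ (i j : Fin n) → opposite j ≤ᶠ opposite i → i ≤ᶠ j
    opposite-cancel-≤ i j le rewrite opposite-prop i | opposite-prop j = s≤s⁻¹ (∸-cancelʳ-≤ (toℕ<n i) le)

  -- Since i ≤ j exactly when i < j + 1, dropping the last left point and the first right point
  -- suffices, at the cost of one in size.
  HalfGraph-<⇒≤ : ∀ {n P X} → HalfGraph (suc n) _<ᶠ_ P X → HalfGraph n _≤ᶠ_ P X
  HalfGraph-<⇒≤ {n} (halfGraph a b Pa Xb a<b) =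
    halfGraph (a ∘ inject₁) (b ∘ suc) (Pa ∘ inject₁) (Xb ∘ suc)
    λ i j → mk⇔ (λ r → subst (_≤ toℕ j) (toℕ-inject₁ i) (s≤s⁻¹ (to (a<b _ _) r)))
                (λ le → from (a<b _ _) (s≤s (subst (_≤ toℕ j) (sym (toℕ-inject₁ i)) le)))
    where open Equivalence

-- Counting with indicator functions.

χ : Bool → ℕ
χ false = 0
χ true  = 1

# : ∀ {n} → (Fin n → Bool) → ℕ
# f = sum (χ ∘ f)

χ-mono : ∀ {a b} → (a ≡ true → b ≡ true) → χ a ≤ χ b
χ-mono {false} a⇒b = z≤n
χ-mono {true}  a⇒b rewrite a⇒b refl = ≤-refl

χ-∧ : ∀ a b → χ (a ∧ b) ≡ χ a * χ b
χ-∧ false b = refl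
χ-∧ true  b = sym (+-identityʳ (χ b))

χ-∧≤ : ∀ a b → χ (a ∧ b) ≤ χ a
χ-∧≤ false b     = z≤n
χ-∧≤ true  false = z≤n
χ-∧≤ true  true  = ≤-refl

-- Of two distinct truth values, one differs from `c`. Summed over a set, this bounds an
-- intersection by two disagreement counts.
χ-disagree : ∀ a b {s t} c → s ≢ t → χ (a ∧ b) ≤ χ (a ∧ (t xor c)) + χ (b ∧ (s xor c))
χ-disagree false b     c s≢t = z≤n
χ-disagree true  false c s≢t = z≤n
χ-disagree true  true {false} {false} c     s≢t = contradiction refl s≢t
χ-disagree true  true {true}  {true}  c     s≢t = contradiction refl s≢t
χ-disagree true  true {false} {true}  false s≢t = ≤-refl
χ-disagree true  true {false} {true}  true  s≢t = ≤-refl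
χ-disagree true  true {true}  {false} false s≢t = ≤-refl
χ-disagree true  true {true}  {false} true  s≢t = ≤-refl

∧-true : ∀ a {b} → a ∧ b ≡ true → a ≡ true × b ≡ true
∧-true true b≡true = refl , b≡true

not-true : ∀ {a} → not a ≡ true → a ≢ true
not-true {false} _ ()

sum-mono-≤ : ∀ {n} {f g : Fin n → ℕ} → (∀ i → f i ≤ g i) → sum f ≤ sum g
sum-mono-≤ {zero}  f≤g = z≤n
sum-mono-≤ {suc n} f≤g = +-mono-≤ (f≤g zero) (sum-mono-≤ (f≤g ∘ suc))

sum-const : ∀ n c → sum {n} (λ _ → c) ≡ n * c
sum-const zero    c = refl
sum-const (suc n) c = cong (c +_) (sum-const n c)

#-inhabited : ∀ {n} (f : Fin n → Bool) → 0 < # f → ∃ λ i → f i ≡ true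
#-inhabited {zero}  f ()
#-inhabited {suc n} f 0<# with f zero in eq
... | true  = zero , eq
... | false with #-inhabited (f ∘ suc) 0<#
...   | i , fi = suc i , fi

∣∣≡# : ∀ {n} (S : Subset n) → ∣ S ∣ ≡ # (lookup S)
∣∣≡# []          = refl
∣∣≡# (false ∷ S) = ∣∣≡# S
∣∣≡# (true  ∷ S) = cong suc (∣∣≡# S)

#-cong : ∀ {n} {f g : Fin n → Bool} → (∀ i → f i ≡ g i) → # f ≡ # g
#-cong f≡g = sum-cong-≗ (cong χ ∘ f≡g)

∣△∣≡# : ∀ {n} (S T : Subset n) → ∣ S △ T ∣ ≡ # (λ i → lookup T i xor lookup S i)
∣△∣≡# []          []          = refl
∣△∣≡# (false ∷ S) (false ∷ T) = ∣△∣≡# S T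
∣△∣≡# (false ∷ S) (true  ∷ T) = cong suc (∣△∣≡# S T)
∣△∣≡# (true  ∷ S) (false ∷ T) = cong suc (∣△∣≡# S T)
∣△∣≡# (true  ∷ S) (true  ∷ T) = ∣△∣≡# S T

∈-tabulate⁻ : ∀ {n} {f : Fin n → Bool} {i} → i ∈ tabulate f → f i ≡ true
∈-tabulate⁻ {f = f} {i} i∈ = trans (sym (lookup∘tabulate f i)) ([]=⇒lookup i∈)

∈-tabulate⁺ : ∀ {n} {f : Fin n → Bool} {i} → f i ≡ true → i ∈ tabulate f
∈-tabulate⁺ {f = f} {i} eq = lookup⇒[]= i _ (trans (lookup∘tabulate f i) eq)

∣tabulate∣≡# : ∀ {n} (f : Fin n → Bool) → ∣ tabulate f ∣ ≡ # f
∣tabulate∣≡# f = trans (∣∣≡# (tabulate f)) (#-cong (lookup∘tabulate f))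

-- Splitting a set of density at least (p / q)ᵉ at a non-negligible fraction
-- (p / q)² (p / q)ᵉ leaves density at least (p / q)²⁺²ᵉ.
exponent : ℕ → ℕ → ℕ
exponent zero    e = e
exponent (suc d) e = exponent d (2 + (e + e))

-- Density, averaging and greedy splitting.

module _ (p q : ℕ) {{_ : NonZero p}} {{_ : NonZero q}}
         {m n : ℕ} {{_ : NonZero n}} (r : Fin m → Fin n → Bool) where

  -- The threshold is quadratic in ∣X∣ because it is later compared with ∣X ∩ w⁻¹X∣, whose average
  -- over the group is ∣X∣² / n.
  Negligible : (Fin n → Bool) → ℕ → Set
  Negligible X c = c * (q * q * n) < p * p * (# X * # X)

  -- With δ = (p / q)² ∣X∣ / n, fewer than δ ∣X∣ elements of X have r g x ≢ b.
  Decides : (Fin n → Bool) → Fin m → Bool → Set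
  Decides X g b = Negligible X (# λ x → X x ∧ (b xor r g x))

  Dense : (Fin n → Bool) → ℕ → Set
  Dense X e = n * p ^ e ≤ # X * q ^ e

  Dense-nonempty : ∀ X e → Dense X e → 0 < # X
  Dense-nonempty X e dense = n≢0⇒n>0 λ #X≡0 →
    <⇒≱ (*-mono-≤ (>-nonZero⁻¹ n) (m^n>0 p e)) (subst (λ s → n * p ^ e ≤ s * q ^ e) #X≡0 dense)

  Dense-nonNegligible : ∀ X Y e → Dense X e → ¬ Negligible X (# Y) → Dense Y (2 + (e + e))
  Dense-nonNegligible X Y e dense ¬small
    rewrite ^-distribˡ-+-* p e e | ^-distribˡ-+-* q e e = *-cancelˡ-≤ n (begin
    n * (n * (p * (p * (P * P))))         ≡⟨ lhs n p P ⟩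
    (p * p) * ((n * P) * (n * P))         ≤⟨ *-monoʳ-≤ (p * p) (*-mono-≤ dense dense) ⟩
    (p * p) * ((# X * Q) * (# X * Q))     ≡⟨ mid p (# X) Q ⟩
    (p * p * (# X * # X)) * (Q * Q)       ≤⟨ *-monoˡ-≤ (Q * Q) (≮⇒≥ ¬small) ⟩
    (# Y * (q * q * n)) * (Q * Q)         ≡⟨ rhs (# Y) q n Q ⟩
    n * (# Y * (q * (q * (Q * Q))))       ∎)
    where
    open ≤-Reasoning
    P = p ^ e
    Q = q ^ e
    lhs : ∀ n p P → n * (n * (p * (p * (P * P)))) ≡ (p * p) * ((n * P) * (n * P))
    lhs = solve-∀
    mid : ∀ p x Q → (p * p) * ((x * Q) * (x * Q)) ≡ (p * p * (x * x)) * (Q * Q)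
    mid = solve-∀
    rhs : ∀ y q n Q → (y * (q * q * n)) * (Q * Q) ≡ n * (y * (q * (q * (Q * Q))))
    rhs = solve-∀

  decides? : ∀ X g b → Dec (Decides X g b)
  decides? X g b = _ <? _

  disagreement : (Fin n → Bool) → (Fin m → Bool) → Fin m → Fin n → Bool
  disagreement X B g x = X x ∧ (B g xor r g x)

  -- Averaging over `X`: the disagreements in columns from `X`, counted by rows, number fewer than m
  -- (p / q)² ∣X∣² / n. If every column were bad, the ∣X∣ columns in `X` would reach that number.
  good-column : ∀ X B {{_ : NonZero m}} → (∀ g → Decides X g (B g)) →
                ∃ λ x → # (λ g → B g xor r g x) * (q * q * n) < p * p * (m * # X)
  good-column X B decides with any? (λ x → # (λ g → B g xor r g x) * (q * q * n) <? p * p * (m * # X))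
  ... | yes found = found
  ... | no none = contradiction (≤-trans upper lower) (<⇒≱ (m<n+m _ (>-nonZero⁻¹ m)))
    where
    open ≤-Reasoning
    err : Fin n → ℕ
    err x = # (λ g → B g xor r g x)
    M : Fin m → ℕ
    M g = # (disagreement X B g)
    double-count : sum (λ x → χ (X x) * err x) ≡ sum M
    double-count = begin-equality
      sum (λ x → χ (X x) * err x)
        ≡⟨ sum-cong-≗ (λ x → *-distribˡ-sum (χ (X x)) (λ g → χ (B g xor r g x))) ⟩
      sum (λ x → sum λ g → χ (X x) * χ (B g xor r g x)) ≡⟨ ∑-comm (λ x g → χ (X x) * χ (B g xor r g x)) ⟩
      sum (λ g → sum λ x → χ (X x) * χ (B g xor r g x))
        ≡⟨ sum-cong-≗ (λ g → sum-cong-≗ (λ x → sym (χ-∧ (X x) (B g xor r g x)))) ⟩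
      sum M                                             ∎
    -- The summand `m` collects the slack of 1 from each of the `m` strict row bounds; as `m` is
    -- nonzero, it makes the comparison with `lower` contradictory.
    upper : m + sum M * (q * q * n) ≤ m * (p * p * (# X * # X))
    upper = begin
      m + sum M * (q * q * n)
        ≡⟨ cong (_+ sum M * (q * q * n)) (trans (sym (*-identityʳ m)) (sym (sum-const m 1))) ⟩
      sum {m} (λ _ → 1) + sum M * (q * q * n)  ≡⟨ cong (sum {m} (λ _ → 1) +_) (*-distribʳ-sum (q * q * n) M) ⟩
      sum {m} (λ _ → 1) + sum (λ g → M g * (q * q * n)) ≡⟨ ∑-distrib-+ (λ _ → 1) (λ g → M g * (q * q * n)) ⟨
      sum (λ g → suc (M g * (q * q * n)))      ≤⟨ sum-mono-≤ decides ⟩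
      sum {m} (λ _ → p * p * (# X * # X))      ≡⟨ sum-const m _ ⟩
      m * (p * p * (# X * # X))                ∎
    lower : m * (p * p * (# X * # X)) ≤ sum M * (q * q * n)
    lower = begin
      m * (p * p * (# X * # X))                        ≡⟨ rearrange m p (# X) ⟩
      # X * (p * p * (m * # X))                        ≡⟨ *-distribʳ-sum (p * p * (m * # X)) (χ ∘ X) ⟩
      sum (λ x → χ (X x) * (p * p * (m * # X)))
        ≤⟨ sum-mono-≤ (λ x → *-monoʳ-≤ (χ (X x)) (≮⇒≥ λ lt → none (x , lt))) ⟩
      sum (λ x → χ (X x) * (err x * (q * q * n)))
        ≡⟨ sum-cong-≗ (λ x → sym (*-assoc (χ (X x)) (err x) _)) ⟩
      sum (λ x → χ (X x) * err x * (q * q * n))        ≡⟨ *-distribʳ-sum (q * q * n) (λ x → χ (X x) * err x) ⟨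
      sum (λ x → χ (X x) * err x) * (q * q * n)        ≡⟨ cong (_* (q * q * n)) double-count ⟩
      sum M * (q * q * n)                              ∎
      where
      rearrange : ∀ m p x → m * (p * p * (x * x)) ≡ x * (p * p * (m * x))
      rearrange = solve-∀

  Adjacent : Fin m → Fin n → Set
  Adjacent g x = r g x ≡ true

  module _ (p≤q : p ≤ q) where

    Dense-suc : ∀ X e → Dense X e → Dense X (suc e)
    Dense-suc X e dense = begin
      n * (p * p ^ e)   ≡⟨ swap n p (p ^ e) ⟩
      p * (n * p ^ e)   ≤⟨ *-mono-≤ p≤q dense ⟩
      q * (# X * q ^ e) ≡⟨ swap q (# X) (q ^ e) ⟩
      # X * (q * q ^ e) ∎
      where
      open ≤-Reasoning
      swap : ∀ a b c → a * (b * c) ≡ b * (a * c)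
      swap = solve-∀

    Dense-+ : ∀ X k e → Dense X e → Dense X (k + e)
    Dense-+ X zero    e dense = dense
    Dense-+ X (suc k) e dense = Dense-suc X (k + e) (Dense-+ X k e dense)

    -- Lets the splitting stop early: as p / q ≤ 1, a larger exponent is a weaker demand, so every
    -- stopping point can share the exponent of full depth.
    Dense-exponent : ∀ X d e → Dense X e → Dense X (exponent d e)
    Dense-exponent X zero    e dense = dense
    Dense-exponent X (suc d) e dense =
      Dense-exponent X d _ (Dense-+ X 2 (e + e) (Dense-+ X e e dense))

    -- If some `g` is undecided on `X`, both halves of `X` cut out by `g` are still dense. Recursion
    -- on them either finds a decided set or gives two trees, which `g` joins.
    decided-or-tree : ∀ d e X → Dense X e →
      (∃ λ Y → Dense Y (exponent d e) × ∀ g → ∃ (Decides Y g)) ⊎ SplitTree Adjacent d U (λ x → X x ≡ true)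
    decided-or-tree zero e X dense = inj₂ (#-inhabited X (Dense-nonempty X e dense))
    decided-or-tree (suc d) e X dense
      with any? (λ g → ¬? (decides? X g false) ×-dec ¬? (decides? X g true))
    ... | no undecided = inj₁ (X , Dense-exponent X (suc d) e dense , decide)
      where
      decide : ∀ g → ∃ (Decides X g)
      decide g with decides? X g false | decides? X g true
      ... | yes f | _     = false , f
      ... | no ¬f | yes t = true , t
      ... | no ¬f | no ¬t = contradiction (g , ¬f , ¬t) undecided
    -- `false xor b` computes to `b` and `true xor b` to `not b`, so failing to decide `false` or
    -- `true` says that the half where `r g x` is true or false, respectively, is not negligible.
    ... | yes (g , ¬f , ¬t)
      with decided-or-tree d (2 + (e + e)) (λ x → X x ∧ r g x) (Dense-nonNegligible X _ e dense ¬f)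
         | decided-or-tree d (2 + (e + e)) (λ x → X x ∧ not (r g x)) (Dense-nonNegligible X _ e dense ¬t)
    ...   | inj₁ found | _          = inj₁ found
    ...   | inj₂ _     | inj₁ found = inj₁ found
    ...   | inj₂ t     | inj₂ u     = inj₂ (g , _
            , SplitTree-mono Adjacent d id (λ {x} → ∧-true (X x)) t
            , SplitTree-mono Adjacent d id (λ {x} eq → proj₁ (∧-true (X x) eq) , not-true (proj₂ (∧-true (X x) eq))) u)

-- Translations and stabilisers in a finite group.

#-permute : ∀ {n} (f : Fin n → Bool) (to from : Fin n → Fin n) →
            (∀ i → to (from i) ≡ i) → (∀ i → from (to i) ≡ i) → # f ≡ # (f ∘ to)
#-permute f to from to∘from from∘to = sum-permute (χ ∘ f) (permutation to from to∘from from∘to)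

module _ (G : FiniteGroup) where
  open FiniteGroup G

  instance
    order-nonZero : NonZero order
    order-nonZero = nonZeroIndex e

  cancelˡ : ∀ x y → inv x · (x · y) ≡ y
  cancelˡ x y = trans (sym (assoc (inv x) x y)) (trans (cong (_· y) (inverseˡ x)) (identityˡ y))

  cancelˡ′ : ∀ x y → x · (inv x · y) ≡ y
  cancelˡ′ x y = trans (sym (assoc x (inv x) y)) (trans (cong (_· y) (inverseʳ x)) (identityˡ y))

  cancelʳ : ∀ x y → (y · x) · inv x ≡ y
  cancelʳ x y = trans (assoc y x (inv x)) (trans (cong (y ·_) (inverseʳ x)) (identityʳ y))

  cancelʳ′ : ∀ x y → (y · inv x) · x ≡ y
  cancelʳ′ x y = trans (assoc y (inv x) x) (trans (cong (y ·_) (inverseˡ x)) (identityʳ y))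

  #-leftTranslate : ∀ f w → # f ≡ # (λ x → f (w · x))
  #-leftTranslate f w = #-permute f (w ·_) (inv w ·_) (cancelˡ′ w) (cancelˡ w)

  #-rightTranslate : ∀ f w → # f ≡ # (λ x → f (x · w))
  #-rightTranslate f w = #-permute f (_· w) (_· inv w) (cancelʳ′ w) (cancelʳ w)

  stabilises? : ∀ (f : Fin order → Bool) w → Dec (∀ g → f g ≡ f (g · w))
  stabilises? f w = all? λ g → f g ≟ f (g · w)

  stabiliser : (Fin order → Bool) → Fin order → Bool
  stabiliser f w = does (stabilises? f w)

  stabiliser⁻ : ∀ f {w} → stabiliser f w ≡ true → ∀ g → f g ≡ f (g · w)
  stabiliser⁻ f {w} eq = invert (subst (Reflects _) eq (proof (stabilises? f w)))

  stabiliser⁺ : ∀ f {w} → (∀ g → f g ≡ f (g · w)) → stabiliser f w ≡ true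
  stabiliser⁺ f {w} = dec-true (stabilises? f w)

  ∈-stabiliser⁻ : ∀ f {w} → w ∈ tabulate (stabiliser f) → ∀ g → f g ≡ f (g · w)
  ∈-stabiliser⁻ f w∈ = stabiliser⁻ f (∈-tabulate⁻ w∈)

  ∈-stabiliser⁺ : ∀ f {w} → (∀ g → f g ≡ f (g · w)) → w ∈ tabulate (stabiliser f)
  ∈-stabiliser⁺ f fixed = ∈-tabulate⁺ (stabiliser⁺ f fixed)

  stabiliser-isSubgroup : ∀ f → IsSubgroup G (tabulate (stabiliser f))
  stabiliser-isSubgroup f =
      ∈-stabiliser⁺ f (λ g → cong f (sym (identityʳ g)))
    , (λ x y x∈ y∈ → ∈-stabiliser⁺ f λ g →
        trans (∈-stabiliser⁻ f x∈ g) (trans (∈-stabiliser⁻ f y∈ (g · x)) (cong f (assoc g x y))))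
    , (λ x x∈ → ∈-stabiliser⁺ f λ g →
        trans (cong f (sym (cancelʳ′ x g))) (sym (∈-stabiliser⁻ f x∈ (g · inv x))))

  -- Right invariance under the stabiliser makes the support of `f` a union of left cosets. The
  -- support itself serves as the set of representatives, each element being reached with h = e.
  unionOfLeftCosets : ∀ f → IsUnionOfLeftCosets G (tabulate (stabiliser f)) (tabulate f)
  unionOfLeftCosets f = tabulate f , λ g → mk⇔
    (λ g∈ → g , g∈ , e , proj₁ (stabiliser-isSubgroup f) , sym (identityʳ g))
    (λ { (t , t∈ , h , h∈ , refl) →
         ∈-tabulate⁺ (trans (sym (∈-stabiliser⁻ f h∈ t)) (∈-tabulate⁻ t∈)) })

  -- If x w x⁻¹ fixes `f`, then w fixes its right translate, and conjugation by x is a bijection.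
  stabiliser-translate : ∀ f x → # (stabiliser f) ≤ # (stabiliser λ g → f (g · inv x))
  stabiliser-translate f x = begin
    # (stabiliser f)                            ≡⟨ #-leftTranslate _ x ⟩
    # (λ w → stabiliser f (x · w))              ≡⟨ #-rightTranslate _ (inv x) ⟩
    # (λ w → stabiliser f (x · (w · inv x)))    ≤⟨ sum-mono-≤ (λ w → χ-mono λ fixed →
      stabiliser⁺ (λ g → f (g · inv x)) λ g → trans (stabiliser⁻ f fixed (g · inv x)) (cong f (conj g w))) ⟩
    # (stabiliser λ g → f (g · inv x))          ∎
    where
    open ≤-Reasoning
    conj : ∀ g w → (g · inv x) · (x · (w · inv x)) ≡ (g · w) · inv x
    conj g w = trans (sym (assoc _ x _)) (trans (cong (_· (w · inv x)) (cancelʳ′ x g)) (sym (assoc g w (inv x))))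

  -- Large stabilisers from decided sets.

  translates : (Fin order → Bool) → Fin order → Fin order → Bool
  translates A g x = A (g · x)

  module _ (p q : ℕ) {{_ : NonZero p}} {{_ : NonZero q}} (2p≤q : 2 * p ≤ q)
           (A : Fin order → Bool) where

    -- ∣X∣² = Σ_w ∣X ∩ w⁻¹X∣, and for w outside the stabiliser of B some g has
    -- B g ≢ B (g w), so that X ∩ w⁻¹X is covered by the disagreement set of g w and
    -- the translate by w⁻¹ of that of g.
    stabiliser-large : ∀ X B → (∀ g → Decides p q (translates A) X g (B g)) → 0 < # X → # X ≤ 2 * # (stabiliser B)
    stabiliser-large X B decides X>0 =
      -- The error terms over all w total at most half of ∣X∣², because (2p)² ≤ q². Doubling the
      -- inequality lets that half be subtracted as `s * (s * K)`, and then `s * K` cancels.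
      *-cancelʳ-≤ s (2 * # H) (s * K) {{m*n≢0 s K {{>-nonZero X>0}} {{K≢0}}}} (+-cancelʳ-≤ (s * (s * K)) _ _ (begin
        s * (s * K) + s * (s * K)                                      ≡⟨ double s K ⟩
        2 * (s * s * K)
          ≡⟨ cong (λ t → 2 * (t * K)) double-count ⟨
        2 * (sum c * K)                                                ≡⟨ cong (2 *_) (*-distribʳ-sum K c) ⟩
        2 * sum (λ w → c w * K)                                        ≤⟨ *-monoʳ-≤ 2 (sum-mono-≤ c≤) ⟩
        2 * sum (λ w → χ (H w) * (s * K) + 2 * (p * p * (s * s)))
          ≡⟨ cong (2 *_) (∑-distrib-+ (λ w → χ (H w) * (s * K)) (λ _ → 2 * (p * p * (s * s)))) ⟩
        2 * (sum (λ w → χ (H w) * (s * K)) + sum {order} (λ _ → 2 * (p * p * (s * s))))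
          ≡⟨ cong (2 *_) (cong₂ _+_ (sym (*-distribʳ-sum (s * K) (χ ∘ H))) (sum-const order _)) ⟩
        2 * (# H * (s * K) + order * (2 * (p * p * (s * s))))          ≡⟨ regroup (# H) s K order p ⟩
        2 * # H * (s * K) + (2 * p) * (2 * p) * (s * s * order)
          ≤⟨ +-monoʳ-≤ (2 * # H * (s * K)) (*-monoˡ-≤ (s * s * order) (*-mono-≤ 2p≤q 2p≤q)) ⟩
        2 * # H * (s * K) + q * q * (s * s * order)
          ≡⟨ cong (2 * # H * (s * K) +_) (collect q s order) ⟩
        2 * # H * (s * K) + s * (s * K)                                ∎))
      where
      open ≤-Reasoning
      s = # X
      K = q * q * order
      K≢0 : NonZero K
      K≢0 = m*n≢0 (q * q) order {{m*n≢0 q q}}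
      double : ∀ s K → s * (s * K) + s * (s * K) ≡ 2 * (s * s * K)
      double = solve-∀
      regroup : ∀ h s K n p → 2 * (h * (s * K) + n * (2 * (p * p * (s * s)))) ≡ 2 * h * (s * K) + (2 * p) * (2 * p) * (s * s * n)
      regroup = solve-∀
      collect : ∀ q s n → q * q * (s * s * n) ≡ s * (s * (q * q * n))
      collect = solve-∀
      H = stabiliser B
      M : Fin order → Fin order → Bool
      M = disagreement p q (translates A) X B
      c : Fin order → ℕ
      c w = # (λ x → X x ∧ X (w · x))
      double-count : sum c ≡ # X * # X
      double-count = begin-equality
        sum c
          ≡⟨ sum-cong-≗ (λ w → sum-cong-≗ λ x → χ-∧ (X x) (X (w · x))) ⟩
        sum (λ w → sum λ x → χ (X x) * χ (X (w · x)))       ≡⟨ ∑-comm (λ w x → χ (X x) * χ (X (w · x))) ⟩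
        sum (λ x → sum λ w → χ (X x) * χ (X (w · x)))
          ≡⟨ sum-cong-≗ (λ x → sym (*-distribˡ-sum (χ (X x)) (λ w → χ (X (w · x))))) ⟩
        sum (λ x → χ (X x) * # (λ w → X (w · x)))
          ≡⟨ sum-cong-≗ (λ x → cong (χ (X x) *_) (sym (#-rightTranslate X x))) ⟩
        sum (λ x → χ (X x) * # X)                           ≡⟨ *-distribʳ-sum (# X) (χ ∘ X) ⟨
        # X * # X                                           ∎
      c≤ : ∀ w → c w * K ≤ χ (H w) * (# X * K) + 2 * (p * p * (# X * # X))
      c≤ w with H w in eq
      ... | true = begin
        c w * K                  ≤⟨ *-monoˡ-≤ K (sum-mono-≤ λ x → χ-∧≤ (X x) (X (w · x))) ⟩
        # X * K                  ≡⟨ *-identityˡ _ ⟨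
        1 * (# X * K)            ≤⟨ m≤m+n _ _ ⟩
        1 * (# X * K) + 2 * (p * p * (# X * # X)) ∎
      ... | false with ¬∀⟶∃¬ order _ (λ g → B g ≟ B (g · w)) (λ fixed → not-¬ eq (stabiliser⁺ B fixed))
      ...   | g , Bg≢ = begin
        c w * K                                             ≤⟨ *-monoˡ-≤ K (sum-mono-≤ pointwise) ⟩
        sum (λ x → χ (M (g · w) x) + χ (M g (w · x))) * K
          ≡⟨ cong (_* K) (∑-distrib-+ (χ ∘ M (g · w)) (λ x → χ (M g (w · x)))) ⟩
        (# (M (g · w)) + # (λ x → M g (w · x))) * K
          ≡⟨ cong (λ s → (# (M (g · w)) + s) * K) (#-leftTranslate (M g) w) ⟨
        (# (M (g · w)) + # (M g)) * K                       ≡⟨ *-distribʳ-+ K (# (M (g · w))) _ ⟩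
        # (M (g · w)) * K + # (M g) * K
          ≤⟨ +-mono-≤ (<⇒≤ (decides (g · w))) (<⇒≤ (decides g)) ⟩
        p * p * (# X * # X) + p * p * (# X * # X)
          ≡⟨ cong (p * p * (# X * # X) +_) (sym (+-identityʳ _)) ⟩
        2 * (p * p * (# X * # X))                           ∎
        where
        pointwise : ∀ x → χ (X x ∧ X (w · x)) ≤ χ (M (g · w) x) + χ (M g (w · x))
        pointwise x rewrite sym (assoc g w x) = χ-disagree (X x) (X (w · x)) (A ((g · w) · x)) Bg≢

  -- Stability and the approximating union of cosets.

  stable⇒¬HalfGraph : ∀ k (A : Subset order) → IsStable G k A → ∀ {P X} →
    ¬ HalfGraph (λ g x → lookup A (g · x) ≡ true) k _≤ᶠ_ P X
  stable⇒¬HalfGraph k A stable (halfGraph a b _ _ adj) = stable (a , b , λ i j → mk⇔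
    (λ ab∈A → Equivalence.to (adj i j) ([]=⇒lookup ab∈A))
    (λ i≤j → lookup⇒[]= _ A (Equivalence.from (adj i j) i≤j)))

  -- The second argument of `treeHeight` is `suc k` because passing from < to ≤ loses one point on
  -- each side.
  stable⇒¬SplitTree : ∀ k (A : Subset order) → IsStable G k A → ∀ {P X} →
    ¬ SplitTree (λ g x → lookup A (g · x) ≡ true) (treeHeight k (suc k)) P X
  stable⇒¬SplitTree k A stable tree
    with SplitTree⇒HalfGraph _ (λ g x → lookup A (g · x) ≟ true) k (suc k) tree
  ... | inj₁ hg = stable⇒¬HalfGraph k A stable (HalfGraph-≥⇒≤ _ hg)
  ... | inj₂ hg = stable⇒¬HalfGraph k A stable (HalfGraph-<⇒≤ _ hg)

  approximation : ∀ k (A : Subset order) → IsStable G k A →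
    (p q : ℕ) {{_ : NonZero p}} {{_ : NonZero q}} → 2 * p ≤ q →
    let C = suc (exponent (treeHeight k (suc k)) 0) in
    Σ (Subset order) λ H → IsSubgroup G H × (order * p ^ C ≤ q ^ C * ∣ H ∣) ×
    Σ (Subset order) λ D → IsUnionOfLeftCosets G H D × (∣ A △ D ∣ * q < p * ∣ H ∣)
  approximation k A stable p q 2p≤q
    -- The splitting starts from the whole group, which has density exponent 0.
    with decided-or-tree p q (translates (lookup A)) (≤-trans (m≤m+n p _) 2p≤q) (treeHeight k (suc k)) 0 (λ _ → true)
           (≤-reflexive (cong (_* 1) (trans (sym (*-identityʳ order)) (sym (sum-const order 1)))))
  ... | inj₂ tree = contradiction tree (stable⇒¬SplitTree k A stable)
  ... | inj₁ (Y , dense , decided)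
    with good-column p q (translates (lookup A)) Y (proj₁ ∘ decided) (proj₂ ∘ decided)
  ... | x , error = tabulate (stabiliser f) , stabiliser-isSubgroup f , index , tabulate f , unionOfLeftCosets f , distance
    where
    open ≤-Reasoning
    n = order
    B = proj₁ ∘ decided
    -- The good column compares B g with membership of g x in `A`. Replacing g by g x⁻¹ turns this
    -- into a comparison of `f` with `A` itself.
    f : Fin order → Bool
    f g = B (g · inv x)
    E = exponent (treeHeight k (suc k)) 0
    y h err : ℕ
    y = # Y
    h = ∣ tabulate (stabiliser f) ∣
    err = # (λ g → B g xor lookup A (g · x))

    y≤2h : y ≤ 2 * h
    y≤2h = begin
      y
        ≤⟨ stabiliser-large p q 2p≤q (lookup A) Y B (proj₂ ∘ decided) (Dense-nonempty p q (translates (lookup A)) Y E dense) ⟩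
      2 * # (stabiliser B)  ≤⟨ *-monoʳ-≤ 2 (stabiliser-translate B x) ⟩
      2 * # (stabiliser f)  ≡⟨ cong (2 *_) (∣tabulate∣≡# (stabiliser f)) ⟨
      2 * h                 ∎

    -- The extra factor p / q ≤ 1/2 in the exponent absorbs the 2 of `y≤2h`.
    index : n * p ^ suc E ≤ q ^ suc E * h
    index = begin
      n * (p * p ^ E)        ≡⟨ swap n p (p ^ E) ⟩
      p * (n * p ^ E)        ≤⟨ *-monoʳ-≤ p dense ⟩
      p * (y * q ^ E)        ≤⟨ *-monoʳ-≤ p (*-monoˡ-≤ (q ^ E) y≤2h) ⟩
      p * (2 * h * q ^ E)    ≡⟨ regroup p h (q ^ E) ⟩
      2 * p * (q ^ E * h)    ≤⟨ *-monoˡ-≤ (q ^ E * h) 2p≤q ⟩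
      q * (q ^ E * h)        ≡⟨ *-assoc q (q ^ E) h ⟨
      q * q ^ E * h          ∎
      where
      swap : ∀ a b c → a * (b * c) ≡ b * (a * c)
      swap = solve-∀
      regroup : ∀ p h Q → p * (2 * h * Q) ≡ 2 * p * (Q * h)
      regroup = solve-∀

    ∣A△D∣ : ∣ A △ tabulate f ∣ ≡ err
    ∣A△D∣ = begin-equality
      ∣ A △ tabulate f ∣                              ≡⟨ ∣△∣≡# A (tabulate f) ⟩
      # (λ g → lookup (tabulate f) g xor lookup A g)
        ≡⟨ #-cong (λ g → cong (_xor lookup A g) (lookup∘tabulate f g)) ⟩
      # (λ g → f g xor lookup A g)                    ≡⟨ #-rightTranslate _ x ⟩
      # (λ g → f (g · x) xor lookup A (g · x))
        ≡⟨ #-cong (λ g → cong (λ g′ → B g′ xor lookup A (g · x)) (cancelʳ x g)) ⟩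
      err                                             ∎

    -- Of the two factors p / q in the error (p / q)² y, one absorbs the 2 of `y≤2h` and the other
    -- is the required ε.
    distance : ∣ A △ tabulate f ∣ * q < p * h
    distance = *-cancelʳ-< (q * n) _ _ (begin-strict
      ∣ A △ tabulate f ∣ * q * (q * n)  ≡⟨ cong (λ t → t * q * (q * n)) ∣A△D∣ ⟩
      err * q * (q * n)                 ≡⟨ lhs err q n ⟩
      err * (q * q * n)                 <⟨ error ⟩
      p * p * (n * y)                   ≤⟨ *-monoʳ-≤ (p * p) (*-monoʳ-≤ n y≤2h) ⟩
      p * p * (n * (2 * h))             ≡⟨ mid p n h ⟩
      2 * p * (p * h * n)               ≤⟨ *-monoˡ-≤ (p * h * n) 2p≤q ⟩
      q * (p * h * n)                   ≡⟨ rhs q (p * h) n ⟩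
      p * h * (q * n)                   ∎)
      where
      lhs : ∀ c q n → c * q * (q * n) ≡ c * (q * q * n)
      lhs = solve-∀
      mid : ∀ p n h → p * p * (n * (2 * h)) ≡ 2 * p * (p * h * n)
      mid = solve-∀
      rhs : ∀ q t n → q * (t * n) ≡ t * (q * n)
      rhs = solve-∀

theorem1p3 : (k : ℕ) → 1 ≤ k → Σ ℕ λ C → (0 < C) × ((G : FiniteGroup) → (A : Subset (FiniteGroup.order G)) → IsStable G k A → (p q : ℕ) → 0 < p → 2 * p ≤ q → Σ (Subset (FiniteGroup.order G)) λ H → IsSubgroup G H × (FiniteGroup.order G * p ^ C ≤ q ^ C * ∣ H ∣) × Σ (Subset (FiniteGroup.order G)) λ D → IsUnionOfLeftCosets G H D × (∣ A △ D ∣ * q < p * ∣ H ∣))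
theorem1p3 k _ = suc (exponent (treeHeight k (suc k)) 0) , z<s , λ G A stable p q p>0 2p≤q →
  approximation G k A stable p q
    {{>-nonZero p>0}} {{>-nonZero (≤-trans p>0 (≤-trans (m≤m+n p _) 2p≤q))}} 2p≤q
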